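{- Let $q(n)=an^2+bn+c$ be a quadratic polynomial with integer coefficients and positive leading coefficient $a$. For each prime $p$ let $m_q(p)=\sup\{k\in\mathbb{N}\cup\{0\}: q(n)\equiv 0 \pmod{p^k}\text{ has an integer solution } n\}$ (possibly $\infty$). Let $p_n$ denote the $n$-th prime, and let $r$ be the least positive integer such that $m_q(p_r)=\infty$ (such $r$ exists). Then there are infinitely many practical numbers of the form $q(n)$ with $n\in\mathbb{N}$ if and only if $p_1^{m_q(p_1)}p_2^{m_q(p_2)}\cdots p_{r-1}^{m_q(p_{r-1})}\,p_r$ is a practical number.
   Context: A positive integer $N$ is called a practical number if every integer in $[1,N]$ can be expressed as a sum of distinct positive divisors of $N$. -}

module Defs where

open import Data.Integer.Base as ℤ using (ℤ; +_)
import Data.Integer.Divisibility as ℤ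
open import Data.List.Base using (List; map; upTo)
open import Data.List.Relation.Unary.All using (All)
open import Data.List.Relation.Unary.Unique.Propositional using (Unique)
open import Data.Nat.Base
open import Data.Nat.Divisibility
  using (_∣_; ∣-trans; ∣1⇒≡1; ∣m+n∣m⇒∣n; m∣m*n; m≤n⇒m!∣n!)
open import Data.Nat.Induction using (<-rec)
open import Data.Nat.ListAction using (sum; product)
open import Data.Nat.Primality using (Prime; prime?; ¬prime[1])
open import Data.Nat.Primality.Factorisation using (factorise)
open import Data.Nat.Properties
  using (_<?_; _≤?_; anyUpTo?; ≮⇒≥; ≰⇒>; <⇒≢; 1≤n!; +-comm)
open import Data.Product.Base using (∃; ∃-syntax; _×_; _,_; proj₁; proj₂)
open import Level using (Level)
open import Relation.Binary.Construct.Add.Supremum.NonStrict _≤_ using (_≤⁺_)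
open import Relation.Binary.PropositionalEquality using (_≡_; sym; subst)
open import Relation.Nullary.Construct.Add.Supremum using (_⁺; [_]; ⊤⁺)
open import Relation.Nullary.Decidable using (yes; no; _×-dec_)
open import Relation.Nullary.Negation using (contradiction)
open import Relation.Unary using (Pred; Decidable)

private
  variable
    ℓ : Level

-- For N ≥ 1 every divisor of N is automatically positive.
IsSumOfDistinctDivisors : ℕ → ℕ → Set
IsSumOfDistinctDivisors N k =
  ∃[ ds ] Unique ds × All (_∣ N) ds × sum ds ≡ k

Practical : ℕ → Set
Practical N = 1 ≤ N × (∀ k → 1 ≤ k → k ≤ N → IsSumOfDistinctDivisors N k)

-- A set of natural numbers is infinite when it is unbounded.
Infinite : Pred ℕ ℓ → Set ℓ
Infinite P = ∀ B → ∃[ N ] B < N × P N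

IsLeast : Pred ℕ ℓ → ℕ → Set ℓ
IsLeast P m = P m × (∀ j → P j → m ≤ j)

ℕ∞ : Set
ℕ∞ = ℕ ⁺

∞ : ℕ∞
∞ = ⊤⁺

-- The value at ∞ is a dummy: when r is the least index of a prime with infinite
-- exponent, criticalNumber only applies finitePart to finite values.
finitePart : ℕ∞ → ℕ
finitePart [ k ] = k
finitePart ⊤⁺    = 0

IsSup : Pred ℕ ℓ → ℕ∞ → Set ℓ
IsSup P s = (∀ k → P k → [ k ] ≤⁺ s)
          × (∀ u → (∀ k → P k → [ k ] ≤⁺ u) → s ≤⁺ u)

least : {P : Pred ℕ ℓ} → Decidable P → ∀ n → P n → ∃ (IsLeast P)
least {P = P} P? = <-rec (λ n → P n → ∃ (IsLeast P)) step
  where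
  step : ∀ n → (∀ {m} → m < n → P m → ∃ (IsLeast P)) → P n → ∃ (IsLeast P)
  step n rec pn with anyUpTo? P? n
  ... | yes (m , m<n , pm) = rec m<n pm
  ... | no none            = n , pn , λ j pj → ≮⇒≥ λ j<n → none (j , j<n , pj)

primeDivisor : ∀ n → 2 ≤ n → ∃[ p ] Prime p × p ∣ n
primeDivisor n@(suc _) 2≤n with factorise n
... | record { factors = List.[] ; isFactorisation = eq } =
  contradiction (sym eq) (<⇒≢ 2≤n)
... | record { factors = p List.∷ ps ; isFactorisation = eq
             ; factorsPrime = pp All.∷ _ } =
  p , pp , subst (p ∣_) (sym eq) (m∣m*n (product ps))

prime-beyond : ∀ n → ∃[ p ] n < p × Prime p
prime-beyond n with primeDivisor (suc (n !)) (s≤s (1≤n! n))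
... | p , pp , p∣1+n! with p ≤? n
...   | no p≰n  = p , ≰⇒> p≰n , pp
...   | yes p≤n =
  contradiction (subst Prime (∣1⇒≡1 p∣1) pp) ¬prime[1]
  where
  p∣p! : ∀ p → Prime p → p ∣ p !
  p∣p! zero    pr = contradiction pr λ ()
  p∣p! (suc k) _  = m∣m*n (k !)

  p∣1 : p ∣ 1
  p∣1 = ∣m+n∣m⇒∣n (subst (p ∣_) (+-comm 1 (n !)) p∣1+n!)
                  (∣-trans (p∣p! p pp) (m≤n⇒m!∣n! p≤n))

leastPrimeAbove : ∀ n → ∃ (IsLeast λ p → n < p × Prime p)
leastPrimeAbove n =
  let p , beyond = prime-beyond n
  in least (λ k → (n <? k) ×-dec prime? k) p beyond

-- Indexed from 0, so that nthPrime 0 = 2 is the first prime.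
nthPrime : ℕ → ℕ
nthPrime zero    = 2
nthPrime (suc i) = proj₁ (leastPrimeAbove (nthPrime i))

quadratic : (a b c : ℤ) → ℤ → ℤ
quadratic a b c n = a ℤ.* n ℤ.^ 2 ℤ.+ b ℤ.* n ℤ.+ c

SolvableMod : (ℤ → ℤ) → ℕ → Set
SolvableMod q d = ∃[ n ] (+ d) ℤ.∣ q n

IsMaxExponent : (ℤ → ℤ) → ℕ → ℕ∞ → Set
IsMaxExponent q p = IsSup λ k → SolvableMod q (p ^ k)

PracticalValue : (ℤ → ℤ) → Pred ℕ _
PracticalValue q N = Practical N × ∃[ n ] 1 ≤ n × + N ≡ q (+ n)

-- The index r is 0-based as in nthPrime: the product runs over all primes
-- strictly below nthPrime r.
criticalNumber : (ℕ → ℕ∞) → ℕ → ℕ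
criticalNumber m r =
  product (map (λ i → nthPrime i ^ finitePart (m (nthPrime i))) (upTo r))
  * nthPrime r

{-# OPTIONS --safe #-}

-- A product n * p is practical as soon as n is and every number below p is a sum of
-- distinct divisors of n: write k as p * (k / p) + k % p.  If N = q(n) is practical and
-- i ≤ r, the divisors of N occurring in a representation of a number below pᵢ are smaller
-- than pᵢ, hence divide the product of the pⱼ ^ m(pⱼ) with j < i; so the critical number
-- is built up by this criterion.
--
-- Conversely let Q = p₁ ^ m(p₁) ⋯ p_{r-1} ^ m(p_{r-1}) * p_r ^ s, let D be the discriminant
-- and suppose D ≠ 0.  A root n ≤ Q of q modulo Q leaves a cofactor of order a Q, which
-- may be too large by a constant factor.  This factor is gained from the identity
--   q(n + k q(n)) = q(n) * (1 + k q′(n) + a k² q(n)):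
-- with f = |k² D - 1|, the congruence q′(n) ≡ - k D modulo f makes both factors on the
-- right divisible by f, so that q(n + k q(n)) = Q f² R₀ R₁ with R₀ ≤ Q f² and
-- R₁ ≤ Q f² R₀.  If D = 0 and f is coprime to 2 a, a root of q′ modulo f is already a
-- root of q modulo f².
--
-- For k = 2 a the same root modulo f > 1 lifts to all powers of f by Hensel, since f is
-- coprime to D, so the prime divisors of f have infinite exponent; if D = 0, those of
-- 2 a + 1 do.
module Submission where

open import Defs
open import Data.Integer.Base using (ℤ; 0ℤ)
open import Data.Nat.Base using (ℕ)
open import Data.Nat.Primality using (Prime)
open import Data.Product.Base using (∃; _×_)
open import Function.Bundles using (_⇔_)
open import Relation.Binary.PropositionalEquality using (_≡_)

-- Bézout relations between integers.

module IntegerQuadratics where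

  open import Data.Integer.Base hiding (suc)
  open import Data.Integer.Divisibility.Signed
  open import Data.Integer.Properties
  open import Data.Integer.Tactic.RingSolver using (solve)
  open import Data.List.Base using ([]; _∷_)
  open import Data.Nat.Base as ℕ using (zero; suc)
  open import Data.Nat.Coprimality using (Coprime; coprime-Bézout)
  import Data.Nat.GCD as GCD
  open import Data.Product.Base using (∃-syntax; _,_)
  open import Relation.Binary.PropositionalEquality hiding (_≡_)
  open ≡-Reasoning

  -- Coprimality is kept as an explicit Bézout identity: signs need no normalising, and closure
  -- properties follow by multiplying identities.
  Comaximal : ℤ → ℤ → Set
  Comaximal x y = ∃[ u ] ∃[ v ] u * x + v * y ≡ 1ℤ

  comaximal-sym : ∀ {x y} → Comaximal x y → Comaximal y x
  comaximal-sym {x} {y} (u , v , eq) = v , u , trans (+-comm (v * y) (u * x)) eq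

  comaximal-* : ∀ {x y z} → Comaximal x y → Comaximal x z → Comaximal x (y * z)
  comaximal-* {x} {y} {z} (u , v , eq) (u′ , v′ , eq′) =
    u * u′ * x + u * v′ * z + v * y * u′ , v * v′ , (begin
      (u * u′ * x + u * v′ * z + v * y * u′) * x + v * v′ * (y * z)
        ≡⟨ solve (u ∷ v ∷ u′ ∷ v′ ∷ x ∷ y ∷ z ∷ []) ⟩
      (u * x + v * y) * (u′ * x + v′ * z)  ≡⟨ cong₂ _*_ eq eq′ ⟩
      1ℤ                                   ∎)

  comaximal-^ : ∀ {x y} → Comaximal x y → ∀ k → Comaximal x (y ^ k)
  comaximal-^ {x} co zero    = 0ℤ , 1ℤ , refl
  comaximal-^     co (suc k) = comaximal-* co (comaximal-^ co k)

  comaximal-∣ʳ : ∀ {x y z} → Comaximal x y → z ∣ y → Comaximal x z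
  comaximal-∣ʳ {x} {_} {z} (u , v , eq) (divides w refl) =
    u , v * w , trans (cong (λ i → u * x + i) (*-assoc v w z)) eq

  -- After multiplication of the Bézout identity by `z`, both summands are multiples of `x`.
  comaximal-cancel : ∀ {x y} z → Comaximal x y → x ∣ y * z → x ∣ z
  comaximal-cancel {x} {y} z (u , v , eq) (divides w yz≡wx) = divides (z * u + v * w) (begin
    z                        ≡⟨ *-identityʳ z ⟨
    z * 1ℤ                   ≡⟨ cong (z *_) eq ⟨
    z * (u * x + v * y)      ≡⟨ solve (z ∷ u ∷ v ∷ x ∷ y ∷ []) ⟩
    z * u * x + v * (y * z)  ≡⟨ cong (λ i → z * u * x + v * i) yz≡wx ⟩
    z * u * x + v * (w * x)  ≡⟨ solve (z ∷ u ∷ v ∷ x ∷ w ∷ []) ⟩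
    (z * u + v * w) * x      ∎)

  comaximal-∣-* : ∀ {x y z} → Comaximal x y → x ∣ z → y ∣ z → x * y ∣ z
  comaximal-∣-* {x} {y} {z} (u , v , eq) (divides w z≡wx) (divides t z≡ty) =
    divides (t * u + w * v) (begin
      z                                ≡⟨ *-identityʳ z ⟨
      z * 1ℤ                           ≡⟨ cong (z *_) eq ⟨
      z * (u * x + v * y)              ≡⟨ solve (z ∷ u ∷ v ∷ x ∷ y ∷ []) ⟩
      z * (u * x) + z * (v * y)        ≡⟨ cong₂ (λ i j → i * (u * x) + j * (v * y)) z≡ty z≡wx ⟩
      t * y * (u * x) + w * x * (v * y)
                                       ≡⟨ solve (t ∷ w ∷ u ∷ v ∷ x ∷ y ∷ []) ⟩
      (t * u + w * v) * (x * y)        ∎)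

  chineseRemainder : ∀ {x y} → Comaximal x y → ∀ i j → ∃[ n ] (x ∣ n - i) × (y ∣ n - j)
  -- `v * y` is 1 modulo `x` and 0 modulo `y`; `u * x` behaves the other way round.
  chineseRemainder {x} {y} (u , v , eq) i j = i * (v * y) + j * (u * x)
    , divides (j * u - i * u) (begin
        i * (v * y) + j * (u * x) - i
          ≡⟨ cong (λ t → i * (v * y) + j * (u * x) - t) (expand i) ⟩
        i * (v * y) + j * (u * x) - i * (u * x + v * y)
          ≡⟨ solve (i ∷ j ∷ u ∷ v ∷ x ∷ y ∷ []) ⟩
        (j * u - i * u) * x                                ∎)
    , divides (i * v - j * v) (begin
        i * (v * y) + j * (u * x) - j
          ≡⟨ cong (λ t → i * (v * y) + j * (u * x) - t) (expand j) ⟩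
        i * (v * y) + j * (u * x) - j * (u * x + v * y)
          ≡⟨ solve (i ∷ j ∷ u ∷ v ∷ x ∷ y ∷ []) ⟩
        (i * v - j * v) * y                                ∎)
    where
    expand : ∀ t → t ≡ t * (u * x + v * y)
    expand t = sym (trans (cong (t *_) eq) (*-identityʳ t))

  1+z-z≡1 : ∀ z → 1ℤ + z - z ≡ 1ℤ
  1+z-z≡1 z = solve (z ∷ [])

  coprime⇒comaximal : ∀ {m n} → Coprime m n → Comaximal (+ m) (+ n)
  coprime⇒comaximal {m} {n} co with coprime-Bézout co
  ... | GCD.Bézout.+- x y eq = + x , - (+ y) , (begin
    + x * + m + - (+ y) * + n
        ≡⟨ cong₂ _+_ (sym (pos-* x m)) (sym (neg-distribˡ-* (+ y) (+ n))) ⟩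
    + (x ℕ.* m) - + y * + n        ≡⟨ cong₂ (λ i j → + i - j) (sym eq) (sym (pos-* y n)) ⟩
    1ℤ + + (y ℕ.* n) - + (y ℕ.* n) ≡⟨ 1+z-z≡1 (+ (y ℕ.* n)) ⟩
    1ℤ                             ∎)
  ... | GCD.Bézout.-+ x y eq = - (+ x) , + y , (begin
    - (+ x) * + m + + y * + n
        ≡⟨ cong₂ _+_ (sym (neg-distribˡ-* (+ x) (+ m))) (sym (pos-* y n)) ⟩
    - (+ x * + m) + + (y ℕ.* n)    ≡⟨ cong₂ (λ i j → - i + + j) (sym (pos-* x m)) (sym eq) ⟩
    - + (x ℕ.* m) + (1ℤ + + (x ℕ.* m)) ≡⟨ +-comm (- + (x ℕ.* m)) _ ⟩
    1ℤ + + (x ℕ.* m) - + (x ℕ.* m) ≡⟨ 1+z-z≡1 (+ (x ℕ.* m)) ⟩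
    1ℤ                             ∎)

  pos-^ : ∀ m k → + (m ℕ.^ k) ≡ (+ m) ^ k
  pos-^ m zero    = refl
  pos-^ m (suc k) = trans (pos-* m (m ℕ.^ k)) (cong (+ m *_) (pos-^ m k))

  -- Quadratic polynomials: Taylor expansion, discriminant and Hensel lifting.

  module Quadratic (a b c : ℤ) where

    q : ℤ → ℤ
    q = quadratic a b c

    slope : ℤ → ℤ
    slope n = + 2 * a * n + b

    disc : ℤ
    disc = b * b - + 4 * a * c

    -- The square in `quadratic` unfolds to `n * (n * 1ℤ)`; the form without powers is the one used
    -- in the ring identities.
    q-expand : ∀ n → q n ≡ a * (n * n) + b * n + c
    q-expand n = cong (λ i → a * (n * i) + b * n + c) (*-identityʳ n)

    q-taylor : ∀ n h → q (n + h) ≡ q n + h * slope n + a * (h * h)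
    q-taylor n h = begin
      q (n + h)  ≡⟨ q-expand (n + h) ⟩
      a * ((n + h) * (n + h)) + b * (n + h) + c
        ≡⟨ solve (a ∷ b ∷ c ∷ n ∷ h ∷ []) ⟩
      a * (n * n) + b * n + c + h * (+ 2 * a * n + b) + a * (h * h)
        ≡⟨ cong (λ i → i + h * slope n + a * (h * h)) (q-expand n) ⟨
      q n + h * slope n + a * (h * h)  ∎

    completeSquare : ∀ n → + 4 * a * q n ≡ slope n * slope n - disc
    completeSquare n = trans (cong (+ 4 * a *_) (q-expand n)) (identity a b c n)
      where
      identity : ∀ a b c n → + 4 * a * (a * (n * n) + b * n + c) ≡
        (+ 2 * a * n + b) * (+ 2 * a * n + b) - (b * b - + 4 * a * c)
      identity a b c n = solve (a ∷ b ∷ c ∷ n ∷ [])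

    ∣-shift : ∀ {d} n h → d ∣ h → d ∣ q n → d ∣ q (n + h)
    ∣-shift {d} n h d∣h d∣q = subst (d ∣_) (sym (q-taylor n h))
      (∣m∣n⇒∣m+n (∣m∣n⇒∣m+n d∣q (∣m⇒∣m*n (slope n) d∣h))
                  (∣n⇒∣m*n a (∣m⇒∣m*n h d∣h)))

    q-resp-≡mod : ∀ {d} x y → d ∣ x - y → d ∣ q y → d ∣ q x
    q-resp-≡mod {d} x y d∣x-y d∣q = subst (λ i → d ∣ q i) (identity x y)
      (∣-shift y (x - y) d∣x-y d∣q)
      where
      identity : ∀ x y → y + (x - y) ≡ x
      identity x y = solve (x ∷ y ∷ [])

    slope-resp-≡mod : ∀ {d} x y → d ∣ x - y → d ∣ slope x - slope y
    slope-resp-≡mod {d} x y d∣x-y = subst (d ∣_) (identity a b x y) (∣n⇒∣m*n (+ 2 * a) d∣x-y)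
      where
      identity : ∀ a b x y → + 2 * a * (x - y) ≡ + 2 * a * x + b - (+ 2 * a * y + b)
      identity a b x y = solve (a ∷ b ∷ x ∷ y ∷ [])

    cofactor : ℤ → ℤ → ℤ
    cofactor k n = 1ℤ + k * slope n + k * k * (a * q n)

    q-multiple : ∀ k n → q (n + k * q n) ≡ q n * cofactor k n
    q-multiple k n = trans (q-taylor n (k * q n)) (identity (q n) k (slope n) a)
      where
      identity : ∀ v k l a → v + k * v * l + a * (k * v * (k * v)) ≡
        v * (1ℤ + k * l + k * k * (a * v))
      identity v k l a = solve (v ∷ k ∷ l ∷ a ∷ [])

    -- At a root modulo `g`, completing the square gives `slope n * slope n ≡ disc`, a unit modulo
    -- `g`. The slope is therefore invertible and a Newton step gains one more power of `g`.
    hensel : ∀ {g} → Comaximal g disc → ∀ n → g ∣ q n → ∀ k → ∃[ n′ ] g ^ suc k ∣ q n′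
    hensel {g} co n g∣q zero = n , subst (_∣ q n) (sym (*-identityʳ g)) g∣q
    hensel {g} co@(u , v , eq) n₀ g∣q (suc k) with hensel co n₀ g∣q k
    ... | n , divides w qn≡ = n + h ,
      divides (w * (u - + 4 * a * v * w * G′) + G′ * (a * (t * t))) (begin
      q (n + h)                                  ≡⟨ q-taylor n h ⟩
      q n + h * s + a * (h * h)                  ≡⟨ cong (λ i → i + h * s + a * (h * h)) qn≡ ⟩
      w * (g * G′) + h * s + a * (h * h)         ≡⟨ identity₁ g G′ w v s a ⟩
      g * G′ * (w * (1ℤ - v * (s * s)) + g * G′ * (a * (t * t)))
        ≡⟨ cong (λ i → g * G′ * (w * i + g * G′ * (a * (t * t)))) inverse ⟩
      g * G′ * (w * (u * g - + 4 * a * v * (w * (g * G′))) + g * G′ * (a * (t * t)))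
        ≡⟨ identity₂ g G′ w u v a t ⟩
      (w * (u - + 4 * a * v * w * G′) + G′ * (a * (t * t))) * (g * (g * G′)) ∎)
      where
      s = slope n
      G′ = g ^ k
      -- Since `v * s` inverts `s` modulo `g`, the first-order term `h * s` cancels
      -- `q n = w * (g * G′)` modulo `g * (g * G′)`.
      t = - (w * v * s)
      h = g * G′ * t

      identity₁ : ∀ g G w v s a → let t = - (w * v * s); h = g * G * t in
        w * (g * G) + h * s + a * (h * h) ≡
        g * G * (w * (1ℤ - v * (s * s)) + g * G * (a * (t * t)))
      identity₁ g G w v s a = solve (g ∷ G ∷ w ∷ v ∷ s ∷ a ∷ [])

      identity₂ : ∀ g G w u v a t →
        g * G * (w * (u * g - + 4 * a * v * (w * (g * G))) + g * G * (a * (t * t))) ≡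
        (w * (u - + 4 * a * v * w * G) + G * (a * (t * t))) * (g * (g * G))
      identity₂ g G w u v a t = solve (g ∷ G ∷ w ∷ u ∷ v ∷ a ∷ t ∷ [])

      identity₃ : ∀ x v s d → x + v * d - v * (s * s) ≡ x - v * (s * s - d)
      identity₃ x v s d = solve (x ∷ v ∷ s ∷ d ∷ [])

      identity₄ : ∀ x v a y → x - v * (+ 4 * a * y) ≡ x - + 4 * a * v * y
      identity₄ x v a y = solve (x ∷ v ∷ a ∷ y ∷ [])

      -- By the Bézout identity `1ℤ - v * disc` is `u * g`, and `s * s` differs from `disc` by
      -- `+ 4 * a * q n`, a multiple of `g * G′`.
      inverse : 1ℤ - v * (s * s) ≡ u * g - + 4 * a * v * (w * (g * G′))
      inverse = begin
        1ℤ - v * (s * s)                     ≡⟨ cong (_- v * (s * s)) eq ⟨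
        u * g + v * disc - v * (s * s)       ≡⟨ identity₃ (u * g) v s disc ⟩
        u * g - v * (s * s - disc)           ≡⟨ cong (λ i → u * g - v * i) (completeSquare n) ⟨
        u * g - v * (+ 4 * a * q n)          ≡⟨ cong (λ i → u * g - v * (+ 4 * a * i)) qn≡ ⟩
        u * g - v * (+ 4 * a * (w * (g * G′)))  ≡⟨ identity₄ (u * g) v a (w * (g * G′)) ⟩
        u * g - + 4 * a * v * (w * (g * G′)) ∎

    -- Modulo F = k² disc - 1 the number k disc is inverse to k, so slope n ≡ - k disc
    -- makes both slope n * slope n - disc and 1 + k * slope n vanish.
    module NonzeroDisc (k₁ : ℤ) where

      -- The factor `+ 2 * a` makes `k * k` a multiple of `+ 4 * a`, so that `F` is comaximal to
      -- `+ 4 * a`; `k₁` stays free to force further comaximality.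
      k : ℤ
      k = + 2 * a * k₁

      F : ℤ
      F = k * k * disc - 1ℤ

      comaximal-kk : Comaximal F (k * k)
      comaximal-kk = -1ℤ , disc , identity (k * k) disc
        where
        identity : ∀ y d → -1ℤ * (y * d - 1ℤ) + d * y ≡ 1ℤ
        identity y d = solve (y ∷ d ∷ [])

      comaximal-k : Comaximal F k
      comaximal-k = comaximal-∣ʳ comaximal-kk (∣m⇒∣m*n k ∣-refl)

      comaximal-4a : Comaximal F (+ 4 * a)
      comaximal-4a = comaximal-∣ʳ comaximal-kk (divides (a * (k₁ * k₁)) (identity a k₁))
        where
        identity : ∀ a k₁ → + 2 * a * k₁ * (+ 2 * a * k₁) ≡ a * (k₁ * k₁) * (+ 4 * a)
        identity a k₁ = solve (a ∷ k₁ ∷ [])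

      comaximal-disc : Comaximal F disc
      comaximal-disc = -1ℤ , k * k , identity (k * k) disc
        where
        identity : ∀ y d → -1ℤ * (y * d - 1ℤ) + y * d ≡ 1ℤ
        identity y d = solve (y ∷ d ∷ [])

      -- Modulo `F` the inverse of `+ 2 * a` is `k₁ * k * disc`, because
      -- `+ 2 * a * k₁ * k * disc = k * k * disc`. This solves `slope n ≡ - k * disc`.
      root : ℤ
      root = - (b + k * disc) * (k₁ * k * disc)

      F∣1+k*slope : F ∣ 1ℤ + k * slope root
      F∣1+k*slope = divides (- (k * b + 1ℤ + k * k * disc)) (identity a b k₁ disc)
        where
        identity : ∀ a b k₁ d → let k = + 2 * a * k₁ in
          1ℤ + k * (+ 2 * a * (- (b + k * d) * (k₁ * k * d)) + b) ≡
          - (k * b + 1ℤ + k * k * d) * (k * k * d - 1ℤ)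
        identity a b k₁ d = solve (a ∷ b ∷ k₁ ∷ d ∷ [])

      -- With `s = slope root`, `(1 + k s)(k s - 1) - F = k² (s² - disc)`, and `F` divides the left
      -- side. Cancelling `k²` and then `4 a` leaves `q root`.
      F∣q : F ∣ q root
      F∣q = comaximal-cancel (q root) comaximal-4a (subst (F ∣_) (sym (completeSquare root))
        (comaximal-cancel (s * s - disc) comaximal-kk (subst (F ∣_) (identity k s disc)
          (∣m∣n⇒∣m-n (∣m⇒∣m*n (k * s - 1ℤ) F∣1+k*slope) ∣-refl))))
        where
        s = slope root
        identity : ∀ k s d → (1ℤ + k * s) * (k * s - 1ℤ) - (k * k * d - 1ℤ) ≡ k * k * (s * s - d)
        identity k s d = solve (k ∷ s ∷ d ∷ [])

    comaximal⇒slopeRoot : ∀ {f} → Comaximal f (+ 2 * a) → ∃[ n ] f ∣ slope n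
    comaximal⇒slopeRoot {f} (u , v , eq) = - (v * b) , divides (b * u) (begin
      + 2 * a * - (v * b) + b
        ≡⟨ cong (λ i → + 2 * a * - (v * b) + i) (*-identityʳ b) ⟨
      + 2 * a * - (v * b) + b * 1ℤ
        ≡⟨ cong (λ i → + 2 * a * - (v * b) + b * i) eq ⟨
      + 2 * a * - (v * b) + b * (u * f + v * (+ 2 * a))
        ≡⟨ identity a b u v f ⟩
      b * u * f  ∎)
      where
      identity : ∀ a b u v f → + 2 * a * - (v * b) + b * (u * f + v * (+ 2 * a)) ≡ b * u * f
      identity a b u v f = solve (a ∷ b ∷ u ∷ v ∷ f ∷ [])

    -- With zero discriminant `+ 4 * a * q n` is the square of the slope, so a divisor of the slope
    -- enters twice.
    disc≡0⇒∣q : ∀ {f} → disc ≡ 0ℤ → Comaximal f (+ 2 * a) → ∀ n → f ∣ slope n → f * f ∣ q n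
    disc≡0⇒∣q {f} disc≡0 co n (divides t s≡tf) = comaximal-cancel (q n) co₄
      (divides (t * t) (begin
        + 4 * a * q n             ≡⟨ completeSquare n ⟩
        slope n * slope n - disc  ≡⟨ cong₂ (λ i j → i * i - j) s≡tf disc≡0 ⟩
        t * f * (t * f) - 0ℤ      ≡⟨ solve (t ∷ f ∷ []) ⟩
        t * t * (f * f)           ∎))
      where
      -- Comaximality is squared in one argument and then in the other; `+ 4 * a` divides the square
      -- of `+ 2 * a`.
      co₄ : Comaximal (f * f) (+ 4 * a)
      co₄ = comaximal-∣ʳ (comaximal-sym (comaximal-* (comaximal-sym co²) (comaximal-sym co²)))
                         (divides a (identity a))
        where
        co² : Comaximal f (+ 2 * a * (+ 2 * a))
        co² = comaximal-* co co
        identity : ∀ a → + 2 * a * (+ 2 * a) ≡ a * (+ 4 * a)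
        identity a = solve (a ∷ [])

-- Practical numbers and their multiples.

module PracticalNumbers where

  open import Data.List.Base using ([]; _∷_; _++_; map; upTo)
  open import Data.List.Membership.Propositional using (_∈_)
  open import Data.List.Membership.Propositional.Properties using (∈-map⁻)
  open import Data.List.Properties using (map-++; upTo-∷ʳ)
  open import Data.List.Relation.Unary.All as All using (All; []; _∷_)
  import Data.List.Relation.Unary.All.Properties as All
  open import Data.List.Relation.Unary.AllPairs as AllPairs using ([])
  import Data.List.Relation.Unary.Unique.Propositional.Properties as Unique
  open import Data.Nat.Base hiding (ℕ)
  open import Data.Nat.Divisibility
  open import Data.Nat.DivMod using (_/_; _%_; m%n<n; m≡m%n+[m/n]*n; m*n/n≡m; /-monoˡ-≤)
  open import Data.Nat.Induction using (<-rec)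
  open import Data.Nat.ListAction using (sum; product)
  open import Data.Nat.ListAction.Properties using (sum-++; product-++)
  open import Data.Nat.Primality using (prime[2]; prime⇒nonTrivial)
  open import Data.Nat.Properties
  open import Data.Product.Base using (∃-syntax; _,_; proj₁; proj₂)
  open import Data.Sum.Base using (inj₁; inj₂; [_,_]′)
  open import Function.Base using (_∘_)
  open import Relation.Binary.PropositionalEquality hiding (_≡_)
  open import Relation.Nullary.Decidable using (yes; no)
  open import Relation.Nullary.Negation using (¬_; contradiction)

  sum-map-* : ∀ p ds → sum (map (p *_) ds) ≡ p * sum ds
  sum-map-* p []       = sym (*-zeroʳ p)
  sum-map-* p (d ∷ ds) =
    trans (cong (λ x → p * d + x) (sum-map-* p ds)) (sym (*-distribˡ-+ p d (sum ds)))

  all-≤-sum : ∀ ds → All (_≤ sum ds) ds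
  all-≤-sum []       = []
  all-≤-sum (d ∷ ds) =
    m≤m+n d _ ∷ All.map (λ x≤ → ≤-trans x≤ (m≤n+m _ d)) (all-≤-sum ds)

  ∣⇒1≤ : ∀ {d n} → 1 ≤ n → d ∣ n → 1 ≤ d
  ∣⇒1≤ {zero}  1≤n 0∣n = contradiction (sym (0∣⇒≡0 0∣n)) (<⇒≢ 1≤n)
  ∣⇒1≤ {suc _} _   _   = s≤s z≤n

  isSum-mono : ∀ {m n k} → m ∣ n →
    IsSumOfDistinctDivisors m k → IsSumOfDistinctDivisors n k
  isSum-mono m∣n (ds , uniq , ds∣m , eq) =
    ds , uniq , All.map (λ d∣m → ∣-trans d∣m m∣n) ds∣m , eq

  practical⇒isSum : ∀ {n k} → Practical n → k ≤ n → IsSumOfDistinctDivisors n k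
  practical⇒isSum {k = zero}  _           _   = [] , [] , [] , refl
  practical⇒isSum {k = suc _} (_ , repr) k≤n = repr _ (s≤s z≤n) k≤n

  practical-1 : Practical 1
  practical-1 = ≤-refl , λ k 1≤k k≤1 →
    1 ∷ [] , [] AllPairs.∷ [] , ∣-refl ∷ [] , ≤-antisym 1≤k k≤1

  -- Divide k by p: the divisors representing the remainder are smaller than p,
  -- hence distinct from the multiples p * d used for the quotient.
  practical-*-extend : ∀ {n} p → 1 ≤ p → Practical n →
    (∀ k → k < p → IsSumOfDistinctDivisors n k) → Practical (n * p)
  practical-*-extend {n} p@(suc _) 1≤p pr@(1≤n , _) small =
    *-mono-≤ 1≤n 1≤p , λ k _ k≤np → represent k k≤np
    where
    represent : ∀ k → k ≤ n * p → IsSumOfDistinctDivisors (n * p) k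
    represent k k≤np
      with small (k % p) (m%n<n k p)
         | practical⇒isSum {k = k / p} pr
             (subst (k / p ≤_) (m*n/n≡m n p) (/-monoˡ-≤ p k≤np))
    ... | es , es! , es∣n , Σes | ds , ds! , ds∣n , Σds =
      es ++ map (p *_) ds
      , Unique.++⁺ es! (Unique.map⁺ (*-cancelˡ-≡ _ _ p) ds!) disjoint
      , All.++⁺ (All.map (∣m⇒∣m*n p) es∣n)
                (All.map⁺ (All.map
                  (λ {d} d∣n → subst (p * d ∣_) (*-comm p n) (*-monoʳ-∣ p d∣n)) ds∣n))
      , (begin
          sum (es ++ map (p *_) ds)        ≡⟨ sum-++ es _ ⟩
          sum es + sum (map (p *_) ds)
            ≡⟨ cong₂ _+_ Σes (trans (sum-map-* p ds) (cong (p *_) Σds)) ⟩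
          k % p + p * (k / p)              ≡⟨ cong (λ x → k % p + x) (*-comm p _) ⟩
          k % p + k / p * p                ≡⟨ m≡m%n+[m/n]*n k p ⟨
          k                                ∎)
      where
      open ≡-Reasoning
      disjoint : ∀ {x} → ¬ (x ∈ es × x ∈ map (p *_) ds)
      disjoint {x} (x∈es , x∈pds) with ∈-map⁻ (p *_) x∈pds
      ... | d , d∈ds , refl = <-irrefl refl
        (<-≤-trans (≤-<-trans (All.lookup (all-≤-sum es) x∈es)
                              (subst (_< p) (sym Σes) (m%n<n k p)))
                   (m≤m*n p d {{>-nonZero (∣⇒1≤ 1≤n (All.lookup ds∣n d∈ds))}}))

  -- Numbers below `j` do not exceed `n`, so practicality of `n` already represents them. Cofactors
  -- of moderate size are attached to a known practical number in this way.
  practical-* : ∀ {n j} → Practical n → 1 ≤ j → j ≤ n → Practical (n * j)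
  practical-* {j = j} pr 1≤j j≤n =
    practical-*-extend j 1≤j pr λ k k<j → practical⇒isSum pr (≤-trans (<⇒≤ k<j) j≤n)

  -- The representations by divisors of `n` remain valid for `n * p ^ e`, so the extension by `p`
  -- can be repeated.
  practical-*^ : ∀ {n p} → 1 ≤ p → Practical n →
    (∀ k → k < p → IsSumOfDistinctDivisors n k) → ∀ e → Practical (n * p ^ e)
  practical-*^ {n} 1≤p pr small zero = subst Practical (sym (*-identityʳ n)) pr
  practical-*^ {n} {p} 1≤p pr small (suc e) =
    subst Practical (trans (*-assoc n (p ^ e) p) (cong (n *_) (*-comm (p ^ e) p)))
      (practical-*-extend p 1≤p (practical-*^ 1≤p pr small e)
        λ k k<p → isSum-mono (m∣m*n (p ^ e)) (small k k<p))

  ^-monoʳ-∣ : ∀ p {j k} → j ≤ k → p ^ j ∣ p ^ k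
  ^-monoʳ-∣ p {j} {k} j≤k = subst (λ x → p ^ j ∣ p ^ x) (m+[n∸m]≡n j≤k)
    (subst (p ^ j ∣_) (sym (^-distribˡ-+-* p j (k ∸ j))) (m∣m*n _))

  -- The enumeration of the primes, and valuations.

  nthPrime-prime : ∀ i → Prime (nthPrime i)
  nthPrime-prime zero    = prime[2]
  nthPrime-prime (suc i) = proj₂ (proj₁ (proj₂ (leastPrimeAbove (nthPrime i))))

  nthPrime-<-suc : ∀ i → nthPrime i < nthPrime (suc i)
  nthPrime-<-suc i = proj₁ (proj₁ (proj₂ (leastPrimeAbove (nthPrime i))))

  nthPrime-gap : ∀ i {p} → Prime p → p < nthPrime (suc i) → p ≤ nthPrime i
  nthPrime-gap i {p} pp p<next = ≮⇒≥ λ pᵢ<p →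
    <⇒≱ p<next (proj₂ (proj₂ (leastPrimeAbove (nthPrime i))) p (pᵢ<p , pp))

  nthPrime-mono-< : ∀ {i j} → i < j → nthPrime i < nthPrime j
  nthPrime-mono-< = go ∘ ≤⇒≤′
    where
    go : ∀ {i j} → suc i ≤′ j → nthPrime i < nthPrime j
    go {i} ≤′-refl               = nthPrime-<-suc i
    go {j = suc j} (≤′-step i<j) = <-trans (go i<j) (nthPrime-<-suc j)

  nthPrime-mono-≤ : ∀ {i j} → i ≤ j → nthPrime i ≤ nthPrime j
  nthPrime-mono-≤ i≤j =
    [ <⇒≤ ∘ nthPrime-mono-< , ≤-reflexive ∘ cong nthPrime ]′ (m≤n⇒m<n∨m≡n i≤j)

  i<nthPrime : ∀ i → i < nthPrime i
  i<nthPrime zero    = s≤s z≤n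
  i<nthPrime (suc i) = ≤-<-trans (i<nthPrime i) (nthPrime-<-suc i)

  1≤prime : ∀ {p} → Prime p → 1 ≤ p
  1≤prime {suc _} _ = s≤s z≤n

  2≤prime : ∀ {p} → Prime p → 2 ≤ p
  2≤prime pp = nonTrivial⇒n>1 _ {{prime⇒nonTrivial pp}}

  -- Index `p` is far enough, since `p < nthPrime p`; from there the search descends through
  -- consecutive primes until it meets `p`.
  prime-isNthPrime : ∀ {p} → Prime p → ∃[ i ] nthPrime i ≡ p
  prime-isNthPrime {p} pp = search p (<⇒≤ (i<nthPrime p))
    where
    search : ∀ j → p ≤ nthPrime j → ∃[ i ] nthPrime i ≡ p
    search zero    p≤2 = zero , ≤-antisym (2≤prime pp) p≤2
    search (suc j) p≤  with m≤n⇒m<n∨m≡n p≤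
    ... | inj₁ p<   = search j (nthPrime-gap j pp p<)
    ... | inj₂ refl = suc j , refl

  valuation : ∀ {p} → 2 ≤ p → ∀ d → 1 ≤ d →
    ∃[ k ] ∃[ e ] d ≡ p ^ k * e × ¬ p ∣ e
  valuation {p} 2≤p = <-rec _ step
    where
    step : ∀ d → (∀ {e} → e < d → 1 ≤ e → ∃[ k ] ∃[ e′ ] e ≡ p ^ k * e′ × ¬ p ∣ e′) →
           1 ≤ d → ∃[ k ] ∃[ e ] d ≡ p ^ k * e × ¬ p ∣ e
    step d rec 1≤d with p ∣? d
    ... | no p∤d = 0 , d , sym (*-identityˡ d) , p∤d
    ... | yes (divides-refl zero) = contradiction 1≤d λ ()
    ... | yes (divides-refl e@(suc _))
        with rec (m<m*n e p 2≤p) (s≤s z≤n)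
    ...   | k , e′ , eq , p∤e′ =
      suc k , e′ , trans (*-comm e p) (trans (cong (p *_) eq) (sym (*-assoc p _ e′))) , p∤e′

  -- From a practical value to the critical number.

  primesBelowPart : (ℕ → ℕ∞) → ℕ → ℕ
  primesBelowPart m i =
    product (map (λ j → nthPrime j ^ finitePart (m (nthPrime j))) (upTo i))

  primesBelowPart-suc : ∀ m i → primesBelowPart m (suc i) ≡
    primesBelowPart m i * nthPrime i ^ finitePart (m (nthPrime i))
  primesBelowPart-suc m i = begin
    product (map f (upTo (suc i)))          ≡⟨ cong (product ∘ map f) (upTo-∷ʳ i) ⟨
    product (map f (upTo i ++ i ∷ []))      ≡⟨ cong product (map-++ f (upTo i) _) ⟩
    product (map f (upTo i) ++ f i ∷ [])    ≡⟨ product-++ (map f (upTo i)) _ ⟩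
    primesBelowPart m i * (f i * 1)         ≡⟨ cong (primesBelowPart m i *_) (*-identityʳ (f i)) ⟩
    primesBelowPart m i * f i               ∎
    where
    open ≡-Reasoning
    f : ℕ → ℕ
    f j = nthPrime j ^ finitePart (m (nthPrime j))

  -- Induction on `i`: split off the full power of `nthPrime i`; the prime divisors of the remaining
  -- factor are below `nthPrime i`, as no prime lies between consecutive ones. At `i = 0` no prime
  -- is below 2, which forces `d` to be 1.
  ∣primesBelowPart : ∀ m i d → 1 ≤ d →
    (∀ {p} → Prime p → p ∣ d → p < nthPrime i) →
    (∀ {j} {k} → j < i → nthPrime j ^ k ∣ d → k ≤ finitePart (m (nthPrime j))) →
    d ∣ primesBelowPart m i
  ∣primesBelowPart m zero d 1≤d smooth _ with d ≤? 1
  ... | yes d≤1 = ∣-reflexive (≤-antisym d≤1 1≤d)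
  ... | no  d≰1 with primeDivisor d (≰⇒> d≰1)
  ...   | p , pp , p∣d = contradiction (2≤prime pp) (<⇒≱ (smooth pp p∣d))
  ∣primesBelowPart m (suc i) d 1≤d smooth bound
    with valuation (2≤prime (nthPrime-prime i)) d 1≤d
  ... | k , e , refl , pᵢ∤e = subst (nthPrime i ^ k * e ∣_)
    (trans (*-comm _ (primesBelowPart m i)) (sym (primesBelowPart-suc m i)))
    (*-pres-∣ (^-monoʳ-∣ (nthPrime i) (bound {k = k} ≤-refl (m∣m*n e)))
      (∣primesBelowPart m i e (∣⇒1≤ 1≤d (n∣m*n (nthPrime i ^ k)))
        (λ {p} pp p∣e → ≤∧≢⇒< (nthPrime-gap i pp (smooth pp (∣n⇒∣m*n (nthPrime i ^ k) p∣e)))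
                      λ {refl → pᵢ∤e p∣e})
        λ {j} {k′} j<i pʲ∣e → bound {j} {k′} (m≤n⇒m≤1+n j<i) (∣n⇒∣m*n (nthPrime i ^ k) pʲ∣e)))

  -- `criticalNumber m r` is `primesBelowPart m r * nthPrime r`. Its prime powers are adjoined in
  -- increasing order, the divisors of `N` supplying the small sums that each extension requires.
  practicalValue⇒practicalCritical : ∀ m r {N} → Practical N → nthPrime r ≤ N →
    (∀ {j k} → j < r → nthPrime j ^ k ∣ N → k ≤ finitePart (m (nthPrime j))) →
    Practical (criticalNumber m r)
  practicalValue⇒practicalCritical m r {N} prN@(1≤N , _) pᵣ≤N bound =
    practical-*-extend (nthPrime r) (1≤prime (nthPrime-prime r))
      (practicalPart r ≤-refl) (small r ≤-refl)
    where
    -- Here `k < nthPrime i ≤ nthPrime r ≤ N`, so `k` lies in the range covered by practicality of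
    -- `N`; no summand exceeds `k`.
    small : ∀ i → i ≤ r → ∀ k → k < nthPrime i →
      IsSumOfDistinctDivisors (primesBelowPart m i) k
    small i i≤r k k<pᵢ with practical⇒isSum {k = k} prN
      (≤-trans (<⇒≤ k<pᵢ) (≤-trans (nthPrime-mono-≤ i≤r) pᵣ≤N))
    ... | ds , ds! , ds∣N , Σds = ds , ds! , All.zipWith divisor (ds∣N , all-≤-sum ds) , Σds
      where
      divisor : ∀ {d} → d ∣ N × d ≤ sum ds → d ∣ primesBelowPart m i
      divisor {d} (d∣N , d≤Σ) = ∣primesBelowPart m i d (∣⇒1≤ 1≤N d∣N)
        (λ _ p∣d → ≤-<-trans (∣⇒≤ {{>-nonZero (∣⇒1≤ 1≤N d∣N)}} p∣d)
                             (≤-<-trans (subst (d ≤_) Σds d≤Σ) k<pᵢ))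
        λ {j} {e} j<i pʲ∣d → bound {j} {e} (<-≤-trans j<i i≤r) (∣-trans pʲ∣d d∣N)

    practicalPart : ∀ i → i ≤ r → Practical (primesBelowPart m i)
    practicalPart zero    _   = practical-1
    practicalPart (suc i) i<r = subst Practical (sym (primesBelowPart-suc m i))
      (practical-*^ (1≤prime (nthPrime-prime i)) (practicalPart i (<⇒≤ i<r))
        (small i (<⇒≤ i<r)) (finitePart (m (nthPrime i))))

-- Suprema of exponents and auxiliary estimates.

module QuadraticValues where

  open IntegerQuadratics
  open PracticalNumbers
  open import Data.Integer.Base as ℤ using (+_; -[1+_]; 1ℤ; ∣_∣)
  import Data.Integer.Divisibility.Signed as ℤ
  import Data.Integer.DivMod as ℤ
  import Data.Integer.Properties as ℤ
  open import Data.Integer.Tactic.RingSolver using (solve)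
  open import Data.List.Base using ([]; _∷_)
  open import Data.Nat.Base hiding (ℕ)
  open import Data.Nat.Coprimality using (prime⇒coprime)
  open import Data.Nat.Divisibility
  open import Data.Nat.Primality using (prime⇒nonZero)
  open import Data.Nat.Properties
  import Data.Nat.Tactic.RingSolver as ℕ-Solver
  open import Data.Product.Base using (∃-syntax; _,_; proj₁; proj₂)
  open import Relation.Binary.Construct.Add.Supremum.NonStrict _≤_ using ([_]; [≤]-injective)
  open import Relation.Binary.PropositionalEquality hiding (_≡_; [_])
  open import Relation.Nullary.Construct.Add.Supremum using ([_]; ⊤⁺)
  open import Relation.Nullary.Decidable using (Dec; yes; no; map′)
  open import Relation.Nullary.Negation using (¬_; contradiction)
  open import Relation.Unary using (Pred; Decidable)

  module _ {ℓ} {P : Pred ℕ ℓ} where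

    -- If `P` failed at `suc k`, then `k` would already be an upper bound, against leastness.
    isSup-attained : ∀ {k} → Decidable P → P 0 → IsSup P [ k ] → P k
    isSup-attained {zero}  _  p₀ _                = p₀
    isSup-attained {suc k} P? _  (upper , lowest) with P? (suc k)
    ... | yes p = p
    ... | no ¬p = contradiction
      ([≤]-injective (lowest [ k ] λ j pj →
        [ s≤s⁻¹ (≤∧≢⇒< ([≤]-injective (upper j pj)) λ {refl → ¬p pj}) ]))
      1+n≰n

    -- A failure at `k` would, by downward closure, make `k` a finite upper bound below `∞`.
    isSup-∞ : Decidable P → (∀ {j k} → j ≤ k → P k → P j) → IsSup P ∞ → ∀ k → P k
    isSup-∞ P? down (_ , lowest) k with P? k
    ... | yes p = p
    ... | no ¬p with lowest [ k ] (λ j pj → [ ≮⇒≥ (λ k<j → ¬p (down (<⇒≤ k<j) pj)) ])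
    ...   | ()

    isSup-unbounded : ∀ {s} → (∀ k → P k) → IsSup P s → s ≡ ∞
    isSup-unbounded {[ k ]} all (upper , _) =
      contradiction ([≤]-injective (upper (suc k) (all (suc k)))) 1+n≰n
    isSup-unbounded {⊤⁺}    _   _           = refl

  isInfinite? : ∀ s → Dec (s ≡ ∞)
  isInfinite? [ _ ] = no λ ()
  isInfinite? ⊤⁺    = yes refl

  finite-≡ : ∀ {s} → ¬ s ≡ ∞ → s ≡ [ finitePart s ]
  finite-≡ {[ _ ]} _   = refl
  finite-≡ {⊤⁺}    s≢∞ = contradiction refl s≢∞

  ^-mono-∣ : ∀ {x y} k → x ℤ.∣ y → x ℤ.^ k ℤ.∣ y ℤ.^ k
  ^-mono-∣ zero _ = ℤ.∣-refl
  ^-mono-∣ {x} {y} (suc k) x∣y =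
    ℤ.∣-trans (ℤ.*-monoˡ-∣ (x ℤ.^ k) x∣y) (ℤ.*-monoʳ-∣ y (^-mono-∣ k x∣y))

  n<m^n : ∀ {m} n → 2 ≤ m → n < m ^ n
  n<m^n         zero    _   = s≤s z≤n
  n<m^n {m} (suc n) 2≤m = begin-strict
    suc n        <⟨ m<m*n (suc n) 2 ≤-refl ⟩
    suc n * 2    ≤⟨ *-mono-≤ (n<m^n n 2≤m) 2≤m ⟩
    m ^ n * m    ≡⟨ *-comm (m ^ n) m ⟩
    m * m ^ n    ∎
    where open ≤-Reasoning

  -- Serves to bound a dominant term `m` with perturbation `i` from below in ℤ by an estimate in ℕ.
  ∣i∣+n≤m⇒n≤m+i : ∀ {m n} i → ∣ i ∣ + n ≤ m → + n ℤ.≤ + m ℤ.+ i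
  ∣i∣+n≤m⇒n≤m+i {m} {n} i ∣i∣+n≤m = begin
    + n                                 ≡⟨ identity (+ ∣ i ∣) (+ n) ⟨
    + (∣ i ∣ + n) ℤ.+ ℤ.- + ∣ i ∣       ≤⟨ ℤ.+-mono-≤ (ℤ.+≤+ ∣i∣+n≤m) (-∣i∣≤i i) ⟩
    + m ℤ.+ i                           ∎
    where
    open ℤ.≤-Reasoning
    identity : ∀ x y → x ℤ.+ y ℤ.- x ≡ y
    identity x y = solve (x ∷ y ∷ [])
    -∣i∣≤i : ∀ i → ℤ.- + ∣ i ∣ ℤ.≤ i
    -∣i∣≤i (+ _)    = ℤ.neg-≤-pos
    -∣i∣≤i -[1+ _ ] = ℤ.≤-refl

  comaximal-suc : ∀ n → Comaximal (+ suc n) (+ n)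
  comaximal-suc n = 1ℤ , ℤ.-1ℤ , identity (+ n)
    where
    identity : ∀ x → 1ℤ ℤ.* (1ℤ ℤ.+ x) ℤ.+ ℤ.-1ℤ ℤ.* x ≡ 1ℤ
    identity x = solve (x ∷ [])

  -- Solvability of the quadratic congruence.

  module Solvability (a b c : ℤ) where
    open Quadratic a b c

    solvable : ∀ {d} n → + d ℤ.∣ q n → SolvableMod q d
    solvable n d∣q = n , ℤ.∣⇒∣ᵤ d∣q

    -- A root reduced modulo `d` is still a root, so a search through the residues below `d`
    -- decides. The lemmas on attained and infinite suprema rely on this decidability.
    solvableMod? : ∀ d → .{{NonZero d}} → Dec (SolvableMod q d)
    solvableMod? d = map′ (λ (n , _ , d∣q) → solvable (+ n) d∣q) residue
      (anyUpTo? (λ n → + d ℤ.∣? q (+ n)) d)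
      where
      residue : SolvableMod q d → ∃[ n ] n < d × + d ℤ.∣ q (+ n)
      residue (x , d∣q) = x ℤ.%ℕ d , ℤ.n%ℕd<d x d , q-resp-≡mod (+ (x ℤ.%ℕ d)) x
        (ℤ.divides (ℤ.- (x ℤ./ℕ d)) (trans
          (cong (λ i → + (x ℤ.%ℕ d) ℤ.- i) (ℤ.a≡a%ℕn+[a/ℕn]*n x d))
          (identity (+ (x ℤ.%ℕ d)) (x ℤ./ℕ d) (+ d)))) (ℤ.∣ᵤ⇒∣ d∣q)
        where
        identity : ∀ r s d → r ℤ.- (r ℤ.+ s ℤ.* d) ≡ ℤ.- s ℤ.* d
        identity r s d = solve (r ∷ s ∷ d ∷ [])

    solvableMod-∣ : ∀ {d e} → d ∣ e → SolvableMod q e → SolvableMod q d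
    solvableMod-∣ d∣e (n , e∣q) = n , ∣-trans d∣e e∣q

    solvableMod-* : ∀ {d e} → Comaximal (+ d) (+ e) →
      SolvableMod q d → SolvableMod q e → SolvableMod q (d * e)
    solvableMod-* {d} {e} co (x , d∣qx) (y , e∣qy) with chineseRemainder co x y
    ... | n , d∣n-x , e∣n-y = solvable n (subst (ℤ._∣ q n) (sym (ℤ.pos-* d e))
      (comaximal-∣-* co (q-resp-≡mod n x d∣n-x (ℤ.∣ᵤ⇒∣ d∣qx))
                          (q-resp-≡mod n y e∣n-y (ℤ.∣ᵤ⇒∣ e∣qy))))

    solvablePower? : ∀ {p} → Prime p → Decidable (λ k → SolvableMod q (p ^ k))
    solvablePower? {p} pp k = solvableMod? (p ^ k) {{m^n≢0 p k {{prime⇒nonZero pp}}}}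

    solvableMod-1 : SolvableMod q 1
    solvableMod-1 = 0ℤ , 1∣ _

  -- A prime with infinite exponent.

  module Positive (α : ℕ) .{{_ : NonZero α}} (b c : ℤ) where

    β γ : ℕ
    β = ∣ b ∣
    γ = ∣ c ∣

    open Quadratic (+ α) b c
    open Solvability (+ α) b c

    ∣2αi∣≡2α∣i∣ : ∀ i → ∣ + 2 ℤ.* + α ℤ.* i ∣ ≡ 2 * α * ∣ i ∣
    ∣2αi∣≡2α∣i∣ i = trans (ℤ.abs-* (+ 2 ℤ.* + α) i) (cong (_* ∣ i ∣) (ℤ.abs-* (+ 2) (+ α)))

    -- A nonzero discriminant has absolute value at least 1, so `k²` is at most the absolute value
    -- of `k² disc = F + 1`.
    ∣k∣²≤∣F∣+1 : disc ≢ 0ℤ → ∀ k₁ → let open NonzeroDisc k₁ in ∣ k ∣ * ∣ k ∣ ≤ ∣ F ∣ + 1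
    ∣k∣²≤∣F∣+1 disc≢0 k₁ = begin
      ∣ k ∣ * ∣ k ∣                ≤⟨ m≤m*n (∣ k ∣ * ∣ k ∣) ∣ disc ∣ {{∣disc∣≢0}} ⟩
      ∣ k ∣ * ∣ k ∣ * ∣ disc ∣     ≡⟨ cong (_* ∣ disc ∣) (ℤ.abs-* k k) ⟨
      ∣ k ℤ.* k ∣ * ∣ disc ∣       ≡⟨ ℤ.abs-* (k ℤ.* k) disc ⟨
      ∣ k ℤ.* k ℤ.* disc ∣         ≡⟨ cong ∣_∣ (identity (k ℤ.* k ℤ.* disc)) ⟩
      ∣ F ℤ.+ 1ℤ ∣                 ≤⟨ ℤ.∣i+j∣≤∣i∣+∣j∣ F 1ℤ ⟩
      ∣ F ∣ + 1                    ∎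
      where
      open NonzeroDisc k₁
      open ≤-Reasoning
      ∣disc∣≢0 : NonZero ∣ disc ∣
      ∣disc∣≢0 = ≢-nonZero λ eq → disc≢0 (ℤ.∣i∣≡0⇒i≡0 eq)
      identity : ∀ x → x ≡ x ℤ.- 1ℤ ℤ.+ 1ℤ
      identity x = solve (x ∷ [])

    liftablePrime : ∃[ p ] Prime p × (∀ k → SolvableMod q (p ^ k))
    liftablePrime with disc ℤ.≟ 0ℤ
    ... | no disc≢0 = fromF
      where
      -- Now `k` is `2 α`, hence `4 ≤ k² ≤ ∣ F ∣ + 1`, and `F` has a prime divisor.
      open NonzeroDisc 1ℤ
      2≤∣F∣ : 2 ≤ ∣ F ∣
      2≤∣F∣ = +-cancelʳ-≤ 1 2 ∣ F ∣
        (≤-trans (≤-trans (m≤n+m 3 1) (*-mono-≤ 2≤∣k∣ 2≤∣k∣)) (∣k∣²≤∣F∣+1 disc≢0 1ℤ))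
        where
        2≤∣k∣ : 2 ≤ ∣ k ∣
        2≤∣k∣ = subst (2 ≤_) (sym (trans (∣2αi∣≡2α∣i∣ 1ℤ) (*-identityʳ _))) (m≤m*n 2 α)
      fromF : ∃[ p ] Prime p × (∀ k → SolvableMod q (p ^ k))
      fromF with primeDivisor ∣ F ∣ 2≤∣F∣
      ... | p , pp , p∣F = p , pp , λ k → powers k (hensel comaximal-disc root F∣q k)
        where
        powers : ∀ k → ∃[ n ] F ℤ.^ suc k ℤ.∣ q n → SolvableMod q (p ^ k)
        powers k (n , F^∣q) = solvableMod-∣ (^-monoʳ-∣ p (n≤1+n k)) (solvable n
          (subst (ℤ._∣ q n) (sym (pos-^ p (suc k)))
            (ℤ.∣-trans (^-mono-∣ (suc k) (ℤ.∣ᵤ⇒∣ {+ p} {F} p∣F)) F^∣q)))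
    -- `1 + 2 * α` is comaximal to `2 * α`, and so are its powers. The linear congruence for the
    -- slope is solved modulo each power directly, in place of lifting.
    ... | yes disc≡0 with primeDivisor (1 + 2 * α) (s≤s (≤-trans (>-nonZero⁻¹ α) (m≤n*m α 2)))
    ...   | p , pp , p∣g = p , pp , λ k → powers k (comaximal⇒slopeRoot (co k))
        where
        g = + (1 + 2 * α)
        co : ∀ k → Comaximal (g ℤ.^ k) (+ 2 ℤ.* + α)
        co k = comaximal-sym (comaximal-^ (subst (λ i → Comaximal i g) (ℤ.pos-* 2 α)
          (comaximal-sym (comaximal-suc (2 * α)))) k)
        powers : ∀ k → ∃[ n ] g ℤ.^ k ℤ.∣ slope n → SolvableMod q (p ^ k)
        powers k (n , g^∣s) = solvable n (subst (ℤ._∣ q n) (sym (pos-^ p k))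
          (ℤ.∣-trans (^-mono-∣ k (ℤ.∣ᵤ⇒∣ {+ p} {g} p∣g))
            (ℤ.∣-trans (ℤ.∣m⇒∣m*n (g ℤ.^ k) ℤ.∣-refl) (disc≡0⇒∣q disc≡0 (co k) n g^∣s))))

  -- Practical products from size estimates.

  1≤m*n⇒1≤n : ∀ m {n} → 1 ≤ m * n → 1 ≤ n
  1≤m*n⇒1≤n m {zero}  1≤m*0 = contradiction (subst (1 ≤_) (*-zeroʳ m) 1≤m*0) λ ()
  1≤m*n⇒1≤n m {suc _} _     = s≤s z≤n

  practical-*-square : ∀ {Q f} → Practical Q → 1 ≤ f → f ≤ Q → Practical (Q * f * f)
  practical-*-square {Q} {f} prQ 1≤f f≤Q =
    practical-* (practical-* prQ 1≤f f≤Q) 1≤f (≤-trans f≤Q (m≤m*n Q f {{>-nonZero 1≤f}}))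

  -- The cofactor `R` of `Q f²` in `V` satisfies `Q f² R = V ≤ A (Q f)² ≤ f² (Q f)² = (Q
  -- f²)²`, hence `R ≤ Q f²`: the square of `f` absorbs the constant `A`.
  practical-square-multiple : ∀ {Q f V A} → Practical Q → 1 ≤ f → f ≤ Q → A ≤ f →
    1 ≤ V → V ≤ A * (Q * f * (Q * f)) → Q * f * f ∣ V → Practical V
  practical-square-multiple {Q} {f} {V} {A} prQ 1≤f f≤Q A≤f 1≤V V≤ (divides R V≡) =
    subst Practical (sym V≡′) (practical-* prQff (1≤m*n⇒1≤n (Q * f * f) (subst (1 ≤_) V≡′ 1≤V)) R≤)
    where
    open ≤-Reasoning
    prQff : Practical (Q * f * f)
    prQff = practical-*-square prQ 1≤f f≤Q
    V≡′ : V ≡ Q * f * f * R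
    V≡′ = trans V≡ (*-comm R (Q * f * f))
    identity : ∀ Q f → f * f * (Q * f * (Q * f)) ≡ Q * f * f * (Q * f * f)
    identity Q f = ℕ-Solver.solve (Q ∷ f ∷ [])
    A≤ff : A ≤ f * f
    A≤ff = ≤-trans A≤f (m≤m*n f f {{>-nonZero 1≤f}})
    R≤ : R ≤ Q * f * f
    R≤ = *-cancelˡ-≤ (Q * f * f) {{>-nonZero (proj₁ prQff)}} (begin
      Q * f * f * R              ≡⟨ V≡′ ⟨
      V                          ≤⟨ V≤ ⟩
      A * (Q * f * (Q * f))      ≤⟨ *-monoˡ-≤ (Q * f * (Q * f)) A≤ff ⟩
      f * f * (Q * f * (Q * f))  ≡⟨ identity Q f ⟩
      Q * f * f * (Q * f * f)    ∎)

  -- Write `V = Q f R₀` and `E = f R₁`. From `V ≤ f (Q f)²` follows `R₀ ≤ Q f²`. From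
  -- `E ≤ C (f + 1) V ≤ (1 + C) f V ≤ f² V` follows `R₁ ≤ Q f² R₀`. Thus `Q f²` can be multiplied by
  -- `R₀` and then by `R₁`.
  practical-product : ∀ {Q f V E A C k} → Practical Q → 1 ≤ f → f ≤ Q → A ≤ f → 1 + C ≤ f →
    1 ≤ V → V ≤ A * (Q * f * (Q * f)) → Q * f ∣ V →
    1 ≤ E → E ≤ C * (k * k * V) → k * k ≤ f + 1 → f ∣ E → Practical (V * E)
  practical-product {Q} {f} {V} {E} {A} {C} {k} prQ 1≤f f≤Q A≤f 1+C≤f
    1≤V V≤ (divides R₀ V≡) 1≤E E≤ kk≤f+1 (divides R₁ E≡) =
    subst Practical (trans (regroup Q f R₀ R₁) (sym (cong₂ _*_ V≡ E≡)))
      (practical-* (practical-* (practical-*-square prQ 1≤f f≤Q) 1≤R₀ R₀≤) 1≤R₁ R₁≤)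
    where
    open ≤-Reasoning
    instance
      f≢0 : NonZero f
      f≢0 = >-nonZero 1≤f
      Q≢0 : NonZero Q
      Q≢0 = >-nonZero (proj₁ prQ)
    V≡′ : V ≡ Q * f * R₀
    V≡′ = trans V≡ (*-comm R₀ (Q * f))
    E≡′ : E ≡ f * R₁
    E≡′ = trans E≡ (*-comm R₁ f)
    1≤R₀ : 1 ≤ R₀
    1≤R₀ = 1≤m*n⇒1≤n (Q * f) (subst (1 ≤_) V≡′ 1≤V)
    1≤R₁ : 1 ≤ R₁
    1≤R₁ = 1≤m*n⇒1≤n f (subst (1 ≤_) E≡′ 1≤E)
    regroup : ∀ Q f R₀ R₁ → Q * f * f * R₀ * R₁ ≡ R₀ * (Q * f) * (R₁ * f)
    regroup Q f R₀ R₁ = ℕ-Solver.solve (Q ∷ f ∷ R₀ ∷ R₁ ∷ [])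
    identity₀ : ∀ Q f → f * (Q * f * (Q * f)) ≡ Q * f * (Q * f * f)
    identity₀ Q f = ℕ-Solver.solve (Q ∷ f ∷ [])
    identity₁ : ∀ C f V → C * ((f + 1) * V) ≡ (C * f + C) * V
    identity₁ C f V = ℕ-Solver.solve (C ∷ f ∷ V ∷ [])
    identity₂ : ∀ Q f R → f * f * (Q * f * R) ≡ f * (Q * f * f * R)
    identity₂ Q f R = ℕ-Solver.solve (Q ∷ f ∷ R ∷ [])
    R₀≤ : R₀ ≤ Q * f * f
    R₀≤ = *-cancelˡ-≤ (Q * f) {{m*n≢0 Q f}} (begin
      Q * f * R₀                 ≡⟨ V≡′ ⟨
      V                          ≤⟨ V≤ ⟩
      A * (Q * f * (Q * f))      ≤⟨ *-monoˡ-≤ (Q * f * (Q * f)) A≤f ⟩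
      f * (Q * f * (Q * f))      ≡⟨ identity₀ Q f ⟩
      Q * f * (Q * f * f)        ∎)
    R₁≤ : R₁ ≤ Q * f * f * R₀
    R₁≤ = *-cancelˡ-≤ f (begin
      f * R₁                     ≡⟨ E≡′ ⟨
      E                          ≤⟨ E≤ ⟩
      C * (k * k * V)            ≤⟨ *-monoʳ-≤ C (*-monoˡ-≤ V kk≤f+1) ⟩
      C * ((f + 1) * V)          ≡⟨ identity₁ C f V ⟩
      (C * f + C) * V            ≤⟨ *-monoˡ-≤ V (+-monoʳ-≤ (C * f) (≤-trans (n≤1+n C) 1+C≤f)) ⟩
      (C * f + f) * V            ≡⟨ cong (_* V) (+-comm (C * f) f) ⟩
      (1 + C) * f * V            ≤⟨ *-monoˡ-≤ V (*-monoˡ-≤ f 1+C≤f) ⟩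
      f * f * V                  ≡⟨ cong (f * f *_) V≡′ ⟩
      f * f * (Q * f * R₀)       ≡⟨ identity₂ Q f R₀ ⟩
      f * (Q * f * f * R₀)       ∎)

  -- The residue modulo `Q * f` is shifted by one period: the lower bound makes the argument large,
  -- the upper one controls the size of the value.
  crtInWindow : ∀ {Q f} → 1 ≤ Q → 1 ≤ f → Comaximal (+ Q) (+ f) → ∀ x y →
    ∃[ n ] Q * f ≤ n × n ≤ 2 * (Q * f) × (+ Q ℤ.∣ + n ℤ.- x) × (+ f ℤ.∣ + n ℤ.- y)
  crtInWindow {Q} {f} 1≤Q 1≤f co x y with chineseRemainder co x y
  ... | z , Q∣z-x , f∣z-y =
    n , m≤n+m (Q * f) r
    , subst (n ≤_) (cong (λ i → Q * f + i) (sym (+-identityʳ (Q * f))))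
        (+-monoˡ-≤ (Q * f) (<⇒≤ (ℤ.n%ℕd<d z (Q * f))))
    , congruent x Q∣z-x (ℤ.∣m⇒∣m*n (+ f) ℤ.∣-refl)
    , congruent y f∣z-y (ℤ.∣n⇒∣m*n (+ Q) ℤ.∣-refl)
    where
    instance
      Qf≢0 : NonZero (Q * f)
      Qf≢0 = >-nonZero (*-mono-≤ 1≤Q 1≤f)
    r = z ℤ.%ℕ (Q * f)
    n = r + Q * f
    congruent : ∀ {d} w → d ℤ.∣ z ℤ.- w → d ℤ.∣ + Q ℤ.* + f → d ℤ.∣ + n ℤ.- w
    congruent {d} w d∣z-w d∣Qf = subst (d ℤ.∣_) eq
      (ℤ.∣m∣n⇒∣m+n d∣z-w (ℤ.∣n⇒∣m*n (1ℤ ℤ.- z ℤ./ℕ (Q * f))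
        (subst (d ℤ.∣_) (sym (ℤ.pos-* Q f)) d∣Qf)))
      where
      identity : ∀ r t x w → r ℤ.+ t ℤ.* x ℤ.- w ℤ.+ (1ℤ ℤ.- t) ℤ.* x ≡ r ℤ.+ x ℤ.- w
      identity r t x w = solve (r ∷ t ∷ x ∷ w ∷ [])
      eq : z ℤ.- w ℤ.+ (1ℤ ℤ.- z ℤ./ℕ (Q * f)) ℤ.* + (Q * f) ≡ + n ℤ.- w
      eq = trans (cong (λ i → i ℤ.- w ℤ.+ (1ℤ ℤ.- z ℤ./ℕ (Q * f)) ℤ.* + (Q * f))
                       (ℤ.a≡a%ℕn+[a/ℕn]*n z (Q * f)))
                 (identity (+ r) (z ℤ./ℕ (Q * f)) (+ (Q * f)) w)

  -- Large practical values of the quadratic.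

  module LargeValues (α : ℕ) .{{_ : NonZero α}} (b c : ℤ) where

    open Quadratic (+ α) b c
    open Solvability (+ α) b c
    open Positive α b c

    -- For such `n` the leading term dominates: `∣ b n + c ∣ + n ≤ (1 + β + γ) n ≤ n² ≤ α n²`. The
    -- value is thus a natural number at least `n`.
    valueAt : ∀ n → 1 + β + γ ≤ n →
      ∃[ V ] + V ≡ q (+ n) × n ≤ V × V ≤ (α + β + γ) * (n * n)
    valueAt n big = V , V≡ , ℤ.drop‿+≤+ (ℤ.≤-trans n≤q (ℤ.≤-reflexive (sym V≡))) , V≤
      where
      open ≤-Reasoning
      V = ∣ q (+ n) ∣
      lower = b ℤ.* + n ℤ.+ c
      q≡ : q (+ n) ≡ + (α * (n * n)) ℤ.+ lower
      q≡ = trans (q-expand (+ n)) (trans (ℤ.+-assoc (+ α ℤ.* (+ n ℤ.* + n)) (b ℤ.* + n) c)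
        (cong (ℤ._+ lower) (sym (trans (ℤ.pos-* α (n * n)) (cong (+ α ℤ.*_) (ℤ.pos-* n n))))))
      1≤n : 1 ≤ n
      1≤n = ≤-trans (s≤s z≤n) big
      n≤nn : n ≤ n * n
      n≤nn = m≤m*n n n {{>-nonZero 1≤n}}
      ∣lower∣≤ : ∣ lower ∣ ≤ β * n + γ
      ∣lower∣≤ = ≤-trans (ℤ.∣i+j∣≤∣i∣+∣j∣ (b ℤ.* + n) c)
        (+-monoˡ-≤ γ (≤-reflexive (ℤ.abs-* b (+ n))))
      n≤q : + n ℤ.≤ q (+ n)
      n≤q = subst (+ n ℤ.≤_) (sym q≡) (∣i∣+n≤m⇒n≤m+i lower (begin
        ∣ lower ∣ + n            ≤⟨ +-monoˡ-≤ n ∣lower∣≤ ⟩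
        β * n + γ + n            ≤⟨ +-monoˡ-≤ n (+-monoʳ-≤ (β * n) (m≤m*n γ n {{>-nonZero 1≤n}})) ⟩
        β * n + γ * n + n        ≡⟨ identity β γ n ⟩
        (1 + β + γ) * n          ≤⟨ *-monoˡ-≤ n big ⟩
        n * n                    ≤⟨ m≤n*m (n * n) α ⟩
        α * (n * n)              ∎))
        where
        identity : ∀ β γ n → β * n + γ * n + n ≡ (1 + β + γ) * n
        identity β γ n = ℕ-Solver.solve (β ∷ γ ∷ n ∷ [])
      V≡ : + V ≡ q (+ n)
      V≡ = ℤ.0≤i⇒+∣i∣≡i (ℤ.≤-trans (ℤ.+≤+ z≤n) n≤q)
      V≤ : V ≤ (α + β + γ) * (n * n)
      V≤ = begin
        V                                      ≡⟨ cong ∣_∣ q≡ ⟩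
        ∣ + (α * (n * n)) ℤ.+ lower ∣          ≤⟨ ℤ.∣i+j∣≤∣i∣+∣j∣ (+ (α * (n * n))) lower ⟩
        α * (n * n) + ∣ lower ∣                ≤⟨ +-monoʳ-≤ (α * (n * n)) ∣lower∣≤ ⟩
        α * (n * n) + (β * n + γ)
          ≤⟨ +-monoʳ-≤ (α * (n * n)) (+-mono-≤ (*-monoʳ-≤ β n≤nn)
               (m≤m*n γ (n * n) {{>-nonZero (≤-trans 1≤n n≤nn)}})) ⟩
        α * (n * n) + (β * (n * n) + γ * (n * n)) ≡⟨ identity α β γ (n * n) ⟩
        (α + β + γ) * (n * n)                  ∎
        where
        identity : ∀ α β γ x → α * x + (β * x + γ * x) ≡ (α + β + γ) * x
        identity α β γ x = ℕ-Solver.solve (α ∷ β ∷ γ ∷ x ∷ [])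

    slopeAt : ∀ n → β ≤ n → ∃[ s ] + s ≡ slope (+ n) × s ≤ 2 * α * n + β
    slopeAt n β≤n = ∣ slope (+ n) ∣ , ℤ.0≤i⇒+∣i∣≡i 0≤slope , (begin
      ∣ slope (+ n) ∣            ≤⟨ ℤ.∣i+j∣≤∣i∣+∣j∣ (+ 2 ℤ.* + α ℤ.* + n) b ⟩
      ∣ + 2 ℤ.* + α ℤ.* + n ∣ + β  ≡⟨ cong (_+ β) (∣2αi∣≡2α∣i∣ (+ n)) ⟩
      2 * α * n + β              ∎)
      where
      open ≤-Reasoning
      2αn≡ : + (2 * α * n) ≡ + 2 ℤ.* + α ℤ.* + n
      2αn≡ = trans (ℤ.pos-* (2 * α) n) (cong (ℤ._* + n) (ℤ.pos-* 2 α))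
      0≤slope : 0ℤ ℤ.≤ slope (+ n)
      0≤slope = subst (λ i → 0ℤ ℤ.≤ i ℤ.+ b) 2αn≡ (∣i∣+n≤m⇒n≤m+i b (begin
        β + 0         ≡⟨ +-identityʳ β ⟩
        β             ≤⟨ β≤n ⟩
        n             ≤⟨ m≤n*m n (2 * α) {{m*n≢0 2 α}} ⟩
        2 * α * n     ∎))

    -- With n ≤ 2 Q f, A bounds q(n) / (Q f)² and C bounds the cofactor divided by k² q(n);
    -- f ≥ T absorbs both.
    A C T : ℕ
    A = 4 * (α + β + γ)
    C = 1 + 3 * α + β
    T = 1 + A + C

    value≤ : ∀ {V n} X → n ≤ 2 * X → V ≤ (α + β + γ) * (n * n) → V ≤ A * (X * X)
    value≤ {V} {n} X n≤2X V≤ = begin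
      V                                  ≤⟨ V≤ ⟩
      (α + β + γ) * (n * n)              ≤⟨ *-monoʳ-≤ (α + β + γ) (*-mono-≤ n≤2X n≤2X) ⟩
      (α + β + γ) * (2 * X * (2 * X))    ≡⟨ identity (α + β + γ) X ⟩
      4 * (α + β + γ) * (X * X)          ∎
      where
      open ≤-Reasoning
      identity : ∀ s X → s * (2 * X * (2 * X)) ≡ 4 * s * (X * X)
      identity s X = ℕ-Solver.solve (s ∷ X ∷ [])

    -- Each summand is compared with `k * k * V` by means of `n ≤ V`; the coefficients `1`,
    -- `2 * α + β` and `α` add up to `C`.
    cofactor≤ : ∀ {n V s} k → 1 ≤ k → 1 ≤ n → n ≤ V → s ≤ 2 * α * n + β →
      1 + k * s + k * k * (α * V) ≤ C * (k * k * V)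
    cofactor≤ {n} {V} {s} k 1≤k 1≤n n≤V s≤ = begin
      1 + k * s + k * k * (α * V)
        ≤⟨ +-monoˡ-≤ _ (+-mono-≤ (*-mono-≤ 1≤kk 1≤V)
             (*-mono-≤ (m≤m*n k k {{>-nonZero 1≤k}}) s≤′)) ⟩
      k * k * V + k * k * (2 * α * V + β * V) + k * k * (α * V)
        ≡⟨ identity (k * k) V α β ⟩
      (1 + 3 * α + β) * (k * k * V)  ∎
      where
      open ≤-Reasoning
      1≤kk : 1 ≤ k * k
      1≤kk = *-mono-≤ 1≤k 1≤k
      1≤V : 1 ≤ V
      1≤V = ≤-trans 1≤n n≤V
      s≤′ : s ≤ 2 * α * V + β * V
      s≤′ = ≤-trans s≤ (+-mono-≤ (*-monoʳ-≤ (2 * α) n≤V) (m≤m*n β V {{>-nonZero 1≤V}}))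
      identity : ∀ x V α β →
        x * V + x * (2 * α * V + β * V) + x * (α * V) ≡ (1 + 3 * α + β) * (x * V)
      identity x V α β = ℕ-Solver.solve (x ∷ V ∷ α ∷ β ∷ [])

    cofactorAt : ∀ {n V s} k → + V ≡ q (+ n) → + s ≡ slope (+ n) →
      + (1 + k * s + k * k * (α * V)) ≡ cofactor (+ k) (+ n)
    cofactorAt {n} {V} {s} k V≡ s≡ = cong₂ (λ i j → 1ℤ ℤ.+ i ℤ.+ j)
      (trans (ℤ.pos-* k s) (cong (+ k ℤ.*_) s≡))
      (trans (ℤ.pos-* (k * k) (α * V)) (cong₂ ℤ._*_ (ℤ.pos-* k k)
        (trans (ℤ.pos-* α V) (cong (+ α ℤ.*_) V≡))))

    module FromWindow {Q f n V : ℕ} (prQ : Practical Q)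
             (1≤f : 1 ≤ f) (T≤f : T ≤ f) (f≤Q : f ≤ Q)
             (Qf≤n : Q * f ≤ n) (n≤2Qf : n ≤ 2 * (Q * f))
             (V≡ : + V ≡ q (+ n)) (n≤V : n ≤ V) (V≤ : V ≤ (α + β + γ) * (n * n)) where

      private
        instance
          f≢0 : NonZero f
          f≢0 = >-nonZero 1≤f
          Q≢0 : NonZero Q
          Q≢0 = >-nonZero (proj₁ prQ)

        Q≤n : Q ≤ n
        Q≤n = ≤-trans (m≤m*n Q f) Qf≤n

        1≤n : 1 ≤ n
        1≤n = ≤-trans (proj₁ prQ) Q≤n

        A≤f : A ≤ f
        A≤f = ≤-trans (≤-trans (m≤n+m A 1) (m≤m+n (1 + A) C)) T≤f

        1+C≤f : 1 + C ≤ f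
        1+C≤f = ≤-trans (s≤s (m≤n+m C A)) T≤f

      squareFactorValue : + Q ℤ.∣ q (+ n) → + f ℤ.* + f ℤ.∣ q (+ n) → Comaximal (+ Q) (+ f) →
        ∃[ N ] Q ≤ N × PracticalValue q N
      squareFactorValue Q∣q ff∣q co = V , ≤-trans Q≤n n≤V
        , practical-square-multiple prQ 1≤f f≤Q A≤f (≤-trans 1≤n n≤V)
            (value≤ (Q * f) n≤2Qf V≤) Qff∣V
        , n , 1≤n , V≡
        where
        Qff∣V : Q * f * f ∣ V
        Qff∣V = ℤ.∣⇒∣ᵤ (subst₂ ℤ._∣_ (trans (cong (+ Q ℤ.*_) (sym (ℤ.pos-* f f)))
          (trans (sym (ℤ.pos-* Q (f * f))) (cong +_ (sym (*-assoc Q f f))))) (sym V≡)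
          (comaximal-∣-* (comaximal-* co co) Q∣q ff∣q))

      -- By `q-multiple` the value at `n + k * V` is `V * E`, and `f` divides `E` because it divides
      -- both `1 + k * slope n` and `q n`.
      compositeValue : ∀ {s} → + s ≡ slope (+ n) → s ≤ 2 * α * n + β →
        ∀ k → 1 ≤ k → k * k ≤ f + 1 → Comaximal (+ Q) (+ f) →
        + Q ℤ.∣ q (+ n) → + f ℤ.∣ q (+ n) → + f ℤ.∣ 1ℤ ℤ.+ + k ℤ.* slope (+ n) →
        ∃[ N ] Q ≤ N × PracticalValue q N
      compositeValue {s} s≡ s≤ k 1≤k kk≤f+1 co Q∣q f∣q f∣1+ks =
        V * E , ≤-trans (≤-trans Q≤n n≤V) (m≤m*n V E)
        , practical-product {k = k} prQ 1≤f f≤Q A≤f 1+C≤f (≤-trans 1≤n n≤V)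
            (value≤ (Q * f) n≤2Qf V≤)
            (ℤ.∣⇒∣ᵤ (subst₂ ℤ._∣_ (sym (ℤ.pos-* Q f)) (sym V≡) (comaximal-∣-* co Q∣q f∣q)))
            (s≤s z≤n) (cofactor≤ k 1≤k 1≤n n≤V s≤) kk≤f+1
            (ℤ.∣⇒∣ᵤ (subst (+ f ℤ.∣_) (sym E≡) f∣cofactor))
        , n + k * V , ≤-trans 1≤n (m≤m+n n (k * V)) , VE≡
        where
        E = 1 + k * s + k * k * (α * V)
        E≡ : + E ≡ cofactor (+ k) (+ n)
        E≡ = cofactorAt {n} {V} {s} k V≡ s≡
        f∣cofactor : + f ℤ.∣ cofactor (+ k) (+ n)
        f∣cofactor = ℤ.∣m∣n⇒∣m+n f∣1+ks (ℤ.∣n⇒∣m*n (+ k ℤ.* + k) (ℤ.∣n⇒∣m*n (+ α) f∣q))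
        VE≡ : + (V * E) ≡ q (+ (n + k * V))
        VE≡ = trans (trans (ℤ.pos-* V E) (cong₂ ℤ._*_ V≡ E≡))
          (trans (sym (q-multiple (+ k) (+ n)))
            (cong (λ i → q (+ n ℤ.+ i)) (trans (cong (+ k ℤ.*_) (sym V≡)) (sym (ℤ.pos-* k V)))))

    -- In the application `M` is `primesBelowPart m r` and `p` is `nthPrime r`. Raising the exponent
    -- of `p` keeps `M * p` practical and the congruence solvable, giving arbitrarily large moduli
    -- `Q`.
    largePracticalValues : ∀ M p → 1 ≤ M → 2 ≤ p → Practical (M * p) →
      (∀ s → SolvableMod q (M * p ^ s)) → Infinite (PracticalValue q)
    largePracticalValues M p 1≤M 2≤p prMp solvableQ B = proof (disc ℤ.≟ 0ℤ)
      where
      open ≤-Reasoning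
      1≤p : 1 ≤ p
      1≤p = ≤-trans (n≤1+n 1) 2≤p

      -- Comaximality to `K` yields comaximality to `M` and `p`, hence to `Q` for every exponent;
      -- the factor `T` makes `f` large.
      K : ℕ
      K = M * p * T

      T≤K : T ≤ K
      T≤K = m≤n*m T (M * p) {{>-nonZero (proj₁ prMp)}}

      -- The exponent s is chosen after f, so that f ≤ Q although f must be comaximal to Q.
      module Modulus (f : ℕ) (T≤f : T ≤ f) (coMp : Comaximal (+ f) (+ K)) where
        -- As `s < Q`, the three summands give `B < Q`, `f ≤ Q`, and arguments large enough for
        -- `valueAt`.
        s = B + f + (1 + β + γ)
        Q = M * p ^ suc s

        s<Q : s < Q
        s<Q = <-≤-trans (<-trans (n<m^n s 2≤p) (^-monoʳ-< p 2≤p (n<1+n s)))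
                        (m≤n*m (p ^ suc s) M {{>-nonZero 1≤M}})

        practicalQ : Practical Q
        practicalQ = subst Practical (*-assoc M p (p ^ s))
          (practical-*^ 1≤p prMp (λ k k<p → practical⇒isSum prMp
            (≤-trans (<⇒≤ k<p) (m≤n*m p M {{>-nonZero 1≤M}}))) s)

        B<Q : B < Q
        B<Q = ≤-<-trans (≤-trans (m≤m+n B f) (m≤m+n (B + f) _)) s<Q

        f≤Q : f ≤ Q
        f≤Q = ≤-trans (≤-trans (m≤n+m f B) (m≤m+n (B + f) _)) (<⇒≤ s<Q)

        1+β+γ≤Q : 1 + β + γ ≤ Q
        1+β+γ≤Q = ≤-trans (m≤n+m _ (B + f)) (<⇒≤ s<Q)

        1≤f : 1 ≤ f
        1≤f = ≤-trans (s≤s z≤n) T≤f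

        coprime : Comaximal (+ Q) (+ f)
        coprime = comaximal-sym (subst (Comaximal (+ f))
          (sym (trans (ℤ.pos-* M (p ^ suc s)) (cong (+ M ℤ.*_) (pos-^ p (suc s)))))
          (comaximal-* (comaximal-∣ʳ coMp (ℤ.∣ᵤ⇒∣ {+ M} {+ K} (∣m⇒∣m*n T (m∣m*n p))))
            (comaximal-^ (comaximal-∣ʳ coMp
              (ℤ.∣ᵤ⇒∣ {+ p} {+ K} (∣m⇒∣m*n T (n∣m*n M)))) (suc s))))

        window : ∀ y → ∃[ n ] Q * f ≤ n × n ≤ 2 * (Q * f) ×
          (+ Q ℤ.∣ q (+ n)) × (+ f ℤ.∣ + n ℤ.- y)
        window y =
          let x , Q∣qx = solvableQ (suc s)
              n , lo , hi , Q∣n-x , f∣n-y = crtInWindow (proj₁ practicalQ) 1≤f coprime x y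
          in n , lo , hi , q-resp-≡mod (+ n) x Q∣n-x (ℤ.∣ᵤ⇒∣ Q∣qx) , f∣n-y

        beyond : ∃[ N ] Q ≤ N × PracticalValue q N → ∃[ N ] B < N × PracticalValue q N
        beyond (N , Q≤N , pv) = N , <-≤-trans B<Q Q≤N , pv

      proof : Dec (disc ≡ 0ℤ) → ∃[ N ] B < N × PracticalValue q N
      proof (yes disc≡0) = beyond (fromRoot (comaximal⇒slopeRoot co2α))
        where
        -- Being 1 modulo `2 * α * K`, `f` is comaximal to `2 * α` and to `K` at once.
        f = suc (2 * α * K)
        co2αK : Comaximal (+ f) (+ (2 * α * K))
        co2αK = comaximal-suc (2 * α * K)
        co2α : Comaximal (+ f) (+ 2 ℤ.* + α)
        co2α = subst (Comaximal (+ f)) (ℤ.pos-* 2 α)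
          (comaximal-∣ʳ co2αK (ℤ.∣ᵤ⇒∣ {+ (2 * α)} {+ (2 * α * K)} (m∣m*n K)))
        T≤f : T ≤ f
        T≤f = ≤-trans T≤K (≤-trans (m≤n*m K (2 * α) {{m*n≢0 2 α}}) (n≤1+n _))
        open Modulus f T≤f (comaximal-∣ʳ co2αK (ℤ.∣ᵤ⇒∣ {+ K} {+ (2 * α * K)} (n∣m*n (2 * α))))
        fromRoot : ∃[ y ] + f ℤ.∣ slope y → ∃[ N ] Q ≤ N × PracticalValue q N
        fromRoot (y , f∣slope) =
          let n , lo , hi , Q∣q , f∣n-y = window y
              big = ≤-trans 1+β+γ≤Q (≤-trans (m≤m*n Q f {{>-nonZero 1≤f}}) lo)
              V , V≡ , n≤V , V≤ = valueAt n big
          in FromWindow.squareFactorValue practicalQ 1≤f T≤f f≤Q lo hi V≡ n≤V V≤ Q∣q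
            (disc≡0⇒∣q disc≡0 co2α (+ n)
              (ℤ.∣m+n∣n⇒∣m (slope-resp-≡mod (+ n) y f∣n-y) (ℤ.∣m⇒∣-m f∣slope))) coprime
      proof (no disc≢0) = beyond fromRoot
        where
        -- With `k₁ = K`, `k` is a multiple of `K`, so comaximality of `F` to `k` includes
        -- comaximality to `K`.
        open NonzeroDisc (+ K) using (k; F; comaximal-k; root; F∣1+k*slope; F∣q)
        κ f : ℕ
        κ = 2 * α * K
        f = ∣ F ∣
        k≡κ : k ≡ + κ
        k≡κ = sym (trans (ℤ.pos-* (2 * α) K) (cong (ℤ._* + K) (ℤ.pos-* 2 α)))
        κκ≤f+1 : κ * κ ≤ f + 1
        κκ≤f+1 = subst (_≤ f + 1) (cong₂ _*_ (cong ∣_∣ k≡κ) (cong ∣_∣ k≡κ))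
          (∣k∣²≤∣F∣+1 disc≢0 (+ K))
        2T≤κ : 2 * T ≤ κ
        2T≤κ = *-mono-≤ (m≤m*n 2 α) T≤K
        1≤κ : 1 ≤ κ
        1≤κ = ≤-trans (s≤s z≤n) 2T≤κ
        T≤f : T ≤ f
        T≤f = +-cancelʳ-≤ 1 T f (begin
          T + 1        ≤⟨ +-monoʳ-≤ T (s≤s z≤n) ⟩
          T + T        ≡⟨ cong (λ i → T + i) (+-identityʳ T) ⟨
          2 * T        ≤⟨ 2T≤κ ⟩
          κ            ≤⟨ m≤m*n κ κ {{>-nonZero 1≤κ}} ⟩
          κ * κ        ≤⟨ κκ≤f+1 ⟩
          f + 1        ∎)
        f∣F : + f ℤ.∣ F
        f∣F = ℤ.∣m∣∣m
        open Modulus f T≤f (comaximal-∣ʳ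
          (comaximal-sym (comaximal-∣ʳ (comaximal-sym comaximal-k) f∣F))
          (ℤ.∣n⇒∣m*n (+ 2 ℤ.* + α) ℤ.∣-refl))
        fromRoot : ∃[ N ] Q ≤ N × PracticalValue q N
        fromRoot =
          let n , lo , hi , Q∣q , f∣n-root = window root
              big = ≤-trans 1+β+γ≤Q (≤-trans (m≤m*n Q f {{>-nonZero 1≤f}}) lo)
              V , V≡ , n≤V , V≤ = valueAt n big
              s , s≡ , s≤ = slopeAt n (≤-trans (≤-trans (m≤n+m β 1) (m≤m+n (1 + β) γ)) big)
          in FromWindow.compositeValue practicalQ 1≤f T≤f f≤Q lo hi V≡ n≤V V≤
            s≡ s≤ κ 1≤κ κκ≤f+1 coprime Q∣q
            (q-resp-≡mod (+ n) root f∣n-root (ℤ.∣-trans f∣F F∣q)) (f∣1+κ*slope n f∣n-root)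
          where
          identity : ∀ k s t → 1ℤ ℤ.+ k ℤ.* t ℤ.+ k ℤ.* (s ℤ.- t) ≡ 1ℤ ℤ.+ k ℤ.* s
          identity k s t = solve (k ∷ s ∷ t ∷ [])
          f∣1+κ*slope : ∀ n → + f ℤ.∣ + n ℤ.- root → + f ℤ.∣ 1ℤ ℤ.+ + κ ℤ.* slope (+ n)
          f∣1+κ*slope n f∣n-root = subst (λ i → + f ℤ.∣ 1ℤ ℤ.+ i ℤ.* slope (+ n)) k≡κ
            (subst (+ f ℤ.∣_) (identity k (slope (+ n)) (slope root))
              (ℤ.∣m∣n⇒∣m+n (ℤ.∣-trans f∣F F∣1+k*slope)
                (ℤ.∣n⇒∣m*n k (slope-resp-≡mod (+ n) root f∣n-root))))

  -- Both directions of the equivalence.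

  comaximal-nthPrime : ∀ {i j} → i < j → Comaximal (+ nthPrime j) (+ nthPrime i)
  comaximal-nthPrime {i} {j} i<j = coprime⇒comaximal
    (prime⇒coprime (nthPrime-prime j) {{prime⇒nonZero (nthPrime-prime i)}} (nthPrime-mono-< i<j))

  comaximal-primesBelowPart : ∀ m i {j} → i ≤ j → Comaximal (+ nthPrime j) (+ primesBelowPart m i)
  comaximal-primesBelowPart m zero    _   = 0ℤ , 1ℤ , refl
  comaximal-primesBelowPart m (suc i) {j} i<j = subst (Comaximal (+ nthPrime j)) eq
    (comaximal-* (comaximal-primesBelowPart m i (<⇒≤ i<j)) (comaximal-^ (comaximal-nthPrime i<j) e))
    where
    e = finitePart (m (nthPrime i))
    eq : + primesBelowPart m i ℤ.* (+ nthPrime i) ℤ.^ e ≡ + primesBelowPart m (suc i)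
    eq = trans (cong (+ primesBelowPart m i ℤ.*_) (sym (pos-^ (nthPrime i) e)))
      (trans (sym (ℤ.pos-* (primesBelowPart m i) (nthPrime i ^ e)))
             (cong +_ (sym (primesBelowPart-suc m i))))

  module MaxExponents (α : ℕ) .{{_ : NonZero α}} (b c : ℤ) (m : ℕ → ℕ∞)
    (maxExponent : ∀ p → Prime p → IsMaxExponent (quadratic (+ α) b c) p (m p)) where

    open Quadratic (+ α) b c
    open Solvability (+ α) b c
    open Positive α b c
    open LargeValues α b c

    infinite⇒solvable : ∀ {p} → Prime p → m p ≡ ∞ → ∀ k → SolvableMod q (p ^ k)
    infinite⇒solvable {p} pp mp≡∞ = isSup-∞ (solvablePower? pp)
      (λ j≤k → solvableMod-∣ (^-monoʳ-∣ p j≤k))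
      (subst (IsMaxExponent q p) mp≡∞ (maxExponent p pp))

    finite⇒solvable : ∀ {p} → Prime p → ¬ m p ≡ ∞ → SolvableMod q (p ^ finitePart (m p))
    finite⇒solvable {p} pp mp≢∞ = isSup-attained (solvablePower? pp) solvableMod-1
      (subst (IsMaxExponent q p) (finite-≡ mp≢∞) (maxExponent p pp))

    finite⇒bound : ∀ {p} k → Prime p → ¬ m p ≡ ∞ → SolvableMod q (p ^ k) → k ≤ finitePart (m p)
    finite⇒bound {p} k pp mp≢∞ solv = [≤]-injective
      (proj₁ (subst (IsMaxExponent q p) (finite-≡ mp≢∞) (maxExponent p pp)) k solv)

    -- The index of the prime from `liftablePrime` bounds the search for the least one.
    leastInfinite : ∃ (IsLeast (λ i → m (nthPrime i) ≡ ∞))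
    leastInfinite with liftablePrime
    ... | p , pp , solv with prime-isNthPrime pp
    ...   | i , refl =
      least (λ j → isInfinite? (m (nthPrime j))) i (isSup-unbounded solv (maxExponent p pp))

    module _ (r : ℕ) (isLeast : IsLeast (λ i → m (nthPrime i) ≡ ∞) r) where

      finiteBelow : ∀ {j} → j < r → ¬ m (nthPrime j) ≡ ∞
      finiteBelow {j} j<r mj≡∞ = <⇒≱ j<r (proj₂ isLeast j mj≡∞)

      critical-practical : Infinite (PracticalValue q) → Practical (criticalNumber m r)
      -- A value beyond `nthPrime r` represents every number below that prime.
      critical-practical inf with inf (nthPrime r)
      ... | N , pᵣ<N , prN , n , _ , N≡q = practicalValue⇒practicalCritical m r prN (<⇒≤ pᵣ<N)
        λ {j} {k} j<r pʲ∣N → finite⇒bound k (nthPrime-prime j) (finiteBelow j<r)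
          (solvable (+ n) (subst (+ (nthPrime j ^ k) ℤ.∣_) N≡q (ℤ.∣ᵤ⇒∣ pʲ∣N)))

      -- Below `r` each exponent is finite and therefore attained; the roots modulo the prime powers
      -- are glued by the Chinese remainder theorem.
      primesBelowPart-solvable : ∀ i → i ≤ r → SolvableMod q (primesBelowPart m i)
      primesBelowPart-solvable zero    _   = solvableMod-1
      primesBelowPart-solvable (suc i) i<r = subst (SolvableMod q) (sym (primesBelowPart-suc m i))
        (solvableMod-* (subst (Comaximal (+ primesBelowPart m i)) (sym (pos-^ (nthPrime i) e))
            (comaximal-^ (comaximal-sym (comaximal-primesBelowPart m i ≤-refl)) e))
          (primesBelowPart-solvable i (<⇒≤ i<r))
          (finite⇒solvable (nthPrime-prime i) (finiteBelow i<r)))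
        where
        e = finitePart (m (nthPrime i))

      infinite-values : Practical (criticalNumber m r) → Infinite (PracticalValue q)
      infinite-values prC = largePracticalValues (primesBelowPart m r) (nthPrime r)
        (1≤x*y⇒1≤x (proj₁ prC)) (2≤prime (nthPrime-prime r)) prC
        λ s → solvableMod-* (subst (Comaximal (+ primesBelowPart m r)) (sym (pos-^ (nthPrime r) s))
                (comaximal-^ (comaximal-sym (comaximal-primesBelowPart m r ≤-refl)) s))
              (primesBelowPart-solvable r ≤-refl)
              (infinite⇒solvable (nthPrime-prime r) (proj₁ isLeast) s)
        where
        1≤x*y⇒1≤x : ∀ {x y} → 1 ≤ x * y → 1 ≤ x
        1≤x*y⇒1≤x {suc _} _ = s≤s z≤n

open import Data.Integer.Base using (_<_; +_; +<+)
open import Data.Nat.Base using (>-nonZero)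
open import Data.Product.Base using (_,_)
open import Function.Bundles using (mk⇔)

theorem2p5 : (a b c : ℤ) → 0ℤ < a →
    let q = quadratic a b c in
    (m : ℕ → ℕ∞) → (∀ p → Prime p → IsMaxExponent q p (m p)) →
    ∃ (IsLeast (λ i → m (nthPrime i) ≡ ∞)) ×
    (∀ r → IsLeast (λ i → m (nthPrime i) ≡ ∞) r →
      Infinite (PracticalValue q) ⇔ Practical (criticalNumber m r))
theorem2p5 (+ α) b c (+<+ 0<α) m maxExponent = leastInfinite ,
  λ r isLeast → mk⇔ (critical-practical r isLeast) (infinite-values r isLeast)
  where open QuadraticValues.MaxExponents α {{>-nonZero 0<α}} b c m maxExponent
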